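{- For all integers $n \ge 1$: (1) the number of D-permutations on $[2n]$ that consist of a single cycle of length $2n$ is equal to the Genocchi number $g_n$; (2) the number of D-permutations on $[2n]$ is equal to the median Genocchi number $h_n$.
   Context: $[m]=\{1,\dots,m\}$. A permutation $\sigma$ of $[2n]$ is a D-permutation if $i\le\sigma(i)$ whenever $i$ is odd and $i\ge\sigma(i)$ whenever $i$ is even. A Dumont permutation on $[2n]$ is a permutation $\sigma$ of $[2n]$ with $2i>\sigma(2i)$ and $2i-1\le\sigma(2i-1)$ for all $i=1,\dots,n$. A Dumont derangement is a Dumont permutation without fixed points, i.e. $2i>\sigma(2i)$ and $2i-1<\sigma(2i-1)$ for all $i=1,\dots,n$. For $n\ge1$ the Genocchi number $g_n$ is defined as the number of Dumont permutations on $[2n-2]$ (so $g_1=1$), and for $n\ge 0$ the median Genocchi number $h_n$ is defined as the number of Dumont derangements on $[2n+2]$. Thus $(g_n)_{n\ge1}=1,1,3,17,155,\dots$ and $(h_n)_{n\ge0}=1,2,8,56,608,\dots$. -}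

module Defs where

open import Data.Fin.Base using (Fin; zero; suc; toℕ; punchIn)
open import Data.Fin.Permutation using
  (Permutation′; _⟨$⟩ʳ_; _≈_; id; insert; remove; insert-remove; insert-punchIn)
open import Data.Fin.Properties using (any?; all?; _≟_; punchIn-injective)
open import Data.List.Base using
  (List; []; _∷_; length; filter; allFin; cartesianProductWith)
open import Data.List.Membership.Propositional.Properties using (∈-allFin)
import Data.List.Membership.Setoid.Properties as Membership
import Data.List.Relation.Unary.All as All
import Data.List.Relation.Unary.AllPairs as AllPairs
open import Data.List.Relation.Unary.Any using (here)
import Data.List.Relation.Unary.Enumerates.Setoid as Enumerates
import Data.List.Relation.Unary.Unique.Propositional.Properties as Unique≡
import Data.List.Relation.Unary.Unique.Setoid as Unique
import Data.List.Relation.Unary.Unique.Setoid.Properties as UniqueP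
open import Data.Nat.Base using (ℕ; zero; suc; _+_; _*_; _∸_; _≤_; _<_; NonZero)
open import Data.Nat.Divisibility using (_∣_; _∤_; _∣?_)
open import Data.Nat.GeneralisedArithmetic using (fold)
open import Data.Nat.Properties using (_≤?_; _<?_)
open import Data.Product.Base using (∃-syntax; _×_; _,_)
open import Level using (0ℓ)
open import Relation.Binary.Bundles using (Setoid)
open import Relation.Binary.PropositionalEquality
  using (_≡_; _≢_; refl; sym; trans; cong; setoid)
open import Relation.Nullary.Decidable using (¬?; _×-dec_; _→-dec_)
open import Relation.Unary using (Pred; Decidable)

private
  variable
    m : ℕ

-- [m] = {1,…,m} is represented by Fin m, the index i standing for the
-- integer label i = 1 + toℕ i.  Parity and size always refer to labels.

label : Fin m → ℕ
label i = suc (toℕ i)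

Odd Even : Pred (Fin m) 0ℓ
Odd  i = 2 ∤ label i
Even i = 2 ∣ label i

odd? : Decidable (Odd {m})
odd? i = ¬? (2 ∣? label i)

even? : Decidable (Even {m})
even? i = 2 ∣? label i

IsDPermutation : Pred (Permutation′ m) 0ℓ
IsDPermutation σ =
    (∀ i → Odd  i → label i ≤ label (σ ⟨$⟩ʳ i))
  × (∀ i → Even i → label (σ ⟨$⟩ʳ i) ≤ label i)

IsDumont : Pred (Permutation′ m) 0ℓ
IsDumont σ =
    (∀ i → Even i → label (σ ⟨$⟩ʳ i) < label i)
  × (∀ i → Odd  i → label i ≤ label (σ ⟨$⟩ʳ i))

IsDumontDerangement : Pred (Permutation′ m) 0ℓ
IsDumontDerangement σ = IsDumont σ × (∀ i → σ ⟨$⟩ʳ i ≢ i)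

-- σ is a single cycle (a, σ a, …, σᵐ⁻¹ a) of length m: these m iterates
-- exhaust [m], hence are pairwise distinct.

IsFullCycle : Pred (Permutation′ m) 0ℓ
IsFullCycle {m} σ = ∃[ a ] ∀ j → ∃[ k ] fold a (σ ⟨$⟩ʳ_) (toℕ {m} k) ≡ j

IsDCycle : Pred (Permutation′ m) 0ℓ
IsDCycle σ = IsDPermutation σ × IsFullCycle σ

isDPermutation? : Decidable (IsDPermutation {m})
isDPermutation? σ =
        all? (λ i → odd?  i →-dec label i ≤? label (σ ⟨$⟩ʳ i))
  ×-dec all? (λ i → even? i →-dec label (σ ⟨$⟩ʳ i) ≤? label i)

isDumont? : Decidable (IsDumont {m})
isDumont? σ =
        all? (λ i → even? i →-dec label (σ ⟨$⟩ʳ i) <? label i)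
  ×-dec all? (λ i → odd?  i →-dec label i ≤? label (σ ⟨$⟩ʳ i))

isDumontDerangement? : Decidable (IsDumontDerangement {m})
isDumontDerangement? σ = isDumont? σ ×-dec all? (λ i → ¬? (σ ⟨$⟩ʳ i ≟ i))

isFullCycle? : Decidable (IsFullCycle {m})
isFullCycle? {m} σ =
  any? λ a → all? λ j → any? λ k → fold a (σ ⟨$⟩ʳ_) (toℕ {m} k) ≟ j

isDCycle? : Decidable (IsDCycle {m})
isDCycle? σ = isDPermutation? σ ×-dec isFullCycle? σ

-- Every permutation of [m], exactly once up to pointwise equality _≈_
-- (proved in permutations-complete and permutations-unique): choose the
-- image of the first element, then a permutation of the remaining ones.

permutations : ∀ m → List (Permutation′ m)
permutations zero    = id ∷ []
permutations (suc m) =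
  cartesianProductWith (insert zero) (allFin (suc m)) (permutations m)

permutationSetoid : ℕ → Setoid 0ℓ 0ℓ
permutationSetoid m = record
  { Carrier       = Permutation′ m
  ; _≈_           = _≈_
  ; isEquivalence = record
    { refl  = λ _ → refl
    ; sym   = λ p i → sym (p i)
    ; trans = λ p q i → trans (p i) (q i)
    }
  }

private
  insert-cong : ∀ {i j} {π ρ : Permutation′ m} → i ≡ j → π ≈ ρ →
                insert zero i π ≈ insert zero j ρ
  insert-cong         refl p zero    = refl
  insert-cong {i = i} {π = π} {ρ} refl p (suc k) =
    trans (insert-punchIn zero i π k)
          (trans (cong (punchIn i) (p k))
                 (sym (insert-punchIn zero i ρ k)))

  insert-injective : ∀ {i j} {π ρ : Permutation′ m} →
                     insert zero i π ≈ insert zero j ρ → i ≡ j × π ≈ ρ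
  insert-injective {i = i} {j} {π} {ρ} p with refl ← p zero =
    refl , λ k → punchIn-injective i _ _
      (trans (sym (insert-punchIn zero i π k))
             (trans (p (suc k)) (insert-punchIn zero i ρ k)))

permutations-complete :
  ∀ m → Enumerates.IsEnumeration (permutationSetoid m) (permutations m)
permutations-complete zero    π = here λ ()
permutations-complete (suc m) π =
  Membership.∈-resp-≈ (permutationSetoid (suc m))
    {x = insert zero (π ⟨$⟩ʳ zero) (remove zero π)} {y = π}
    (insert-remove zero π)
    (Membership.∈-cartesianProductWith⁺
      (setoid (Fin (suc m))) (permutationSetoid m) (permutationSetoid (suc m))
      (λ {_} {_} {π′} {ρ} → insert-cong {π = π′} {ρ})
      (∈-allFin (π ⟨$⟩ʳ zero))
      (permutations-complete m (remove zero π)))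

permutations-unique :
  ∀ m → Unique.Unique (permutationSetoid m) (permutations m)
permutations-unique zero    = All.[] AllPairs.∷ AllPairs.[]
permutations-unique (suc m) =
  UniqueP.cartesianProductWith⁺
    (setoid (Fin (suc m))) (permutationSetoid m) (permutationSetoid (suc m))
    (insert zero) (λ {_} {_} {π} {ρ} → insert-injective {π = π} {ρ})
    (Unique≡.allFin⁺ (suc m)) (permutations-unique m)

-- The number of permutations of [m] satisfying P.

count : {P : Pred (Permutation′ m) 0ℓ} → Decidable P → ℕ
count {m} P? = length (filter P? (permutations m))

#DPermutations : ℕ → ℕ
#DPermutations n = count (isDPermutation? {2 * n})

#DCycles : ℕ → ℕ
#DCycles n = count (isDCycle? {2 * n})

genocchi : ∀ n → .{{NonZero n}} → ℕ
genocchi n = count (isDumont? {2 * n ∸ 2})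

medianGenocchi : ℕ → ℕ
medianGenocchi n = count (isDumontDerangement? {2 * n + 2})

{-# OPTIONS --safe #-}

-- (1) Both objects are built up by splicing a new least element 0 into the
-- cycles of a permutation of a smaller set.  For a permutation σ of [m] and a
-- cycle c on [m + 2] with c (m + 1) = m + 2, splicing 0 in after some p ≤ m
-- turns p into a descent and 0 into an ascent on both sides, while making 0 a
-- fixed point of σ (a weak ascent) corresponds to splicing it in after the
-- maximum of c.  So σ k ≥ k if and only if c k > k throughout: this is a
-- recursive form of Foata's fundamental transformation.
--
-- (2) Composing a Dumont derangement on [2n + 2] with the involution
-- 2j - 1 ↔ 2j yields a permutation that fixes 1 and 2n + 2 and is a
-- D-permutation, shifted by one, in between.

module Submission where

open import Defs
open import Data.Fin.Base as Fin using (Fin; zero; suc; toℕ; fromℕ; fromℕ<; inject₁; punchIn)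
open import Data.Fin.Patterns using (0F; 1F)
open import Data.Fin.Permutation
  using (Permutation′; _⟨$⟩ʳ_; _⟨$⟩ˡ_; _≈_; _∘ₚ_; id; lift₀; lift₀-cong; lift₀-remove;
         transpose; swap; insert; remove; insert-punchIn; insert-remove; inverseʳ)
import Data.Fin.Permutation.Components as PC
open import Data.Fin.Properties
  using (_≟_; toℕ-inject₁; toℕ-fromℕ; toℕ-fromℕ<; toℕ<n; ≤fromℕ; fromℕ≢inject₁;
         inject₁-injective; suc-injective; toℕ-injective; injective⇒≤; pigeonhole)
open import Data.Fin.Relation.Unary.Top using (view; ‵fromℕ; ‵inj₁)
open import Data.List.Base as List using (_∷_; filter)
open import Data.List.Membership.Setoid.Properties using (∈-filter⁺; index-injective)
open import Data.List.Membership.Propositional.Properties using (∈-lookup)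
import Data.List.Relation.Unary.All as All
import Data.List.Relation.Unary.All.Properties as All
open import Data.List.Relation.Unary.AllPairs using (_∷_)
open import Data.List.Relation.Unary.Any using (index)
import Data.List.Relation.Unary.Unique.Setoid as Unique
import Data.List.Relation.Unary.Unique.Setoid.Properties as Unique
open import Data.Nat.Base as ℕ using (ℕ; zero; suc; _+_; _*_; _∸_; _≤_; _<_; z≤n; s≤s; s<s; s≤s⁻¹; s<s⁻¹; NonZero)
open import Data.Nat.Divisibility using (_∣_; _∤_; divides; divides-refl; ∣m∣n⇒∣m+n; ∣m+n∣m⇒∣n; ∣-refl; >⇒∤)
open import Data.Nat.DivMod using (_%_; _/_; m≡m%n+[m/n]*n; m%n<n)
open import Data.Nat.GeneralisedArithmetic using (fold; fold-+)
open import Data.Nat.Properties as ℕ using (≤-antisym; *-comm; +-comm)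
open import Data.Product.Base using (∃-syntax; _×_; _,_; proj₁; proj₂)
open import Data.Sum.Base using (_⊎_; inj₁; inj₂)
open import Function.Base using (_∘_; flip)
open import Function.Bundles using (Injection; _⇔_; mk⇔; Equivalence)
open import Function.Properties.Inverse using (↔⇒↣)
open import Level using (0ℓ)
open import Relation.Binary.Definitions using (_Respects_)
open import Relation.Binary.PropositionalEquality
  using (_≡_; _≢_; refl; sym; trans; cong; subst; subst₂; module ≡-Reasoning)
open import Relation.Nullary using (yes; no; contradiction)
open import Relation.Nullary.Decidable using (dec-true; dec-false)
open import Relation.Unary using (Pred; Decidable)

private
  variable
    m n : ℕ

⟨$⟩ʳ-injective : (π : Permutation′ m) → ∀ {i j} → π ⟨$⟩ʳ i ≡ π ⟨$⟩ʳ j → i ≡ j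
⟨$⟩ʳ-injective π = Injection.injective (↔⇒↣ π)

-- Counting

lookup-injective : ∀ {xs} → Unique.Unique (permutationSetoid m) xs →
                   ∀ i j → List.lookup xs i ≈ List.lookup xs j → i ≡ j
lookup-injective (_ ∷ _)   zero    zero    _ = refl
lookup-injective (x∉ ∷ _)  zero    (suc j) p = contradiction p (All.lookup x∉ (∈-lookup j))
lookup-injective (x∉ ∷ _)  (suc i) zero    p = contradiction (λ k → sym (p k)) (All.lookup x∉ (∈-lookup i))
lookup-injective (_ ∷ xs!) (suc i) (suc j) p = cong suc (lookup-injective xs! i j p)

-- The correspondence is a relation `R` because permutations agree only up to `_≈_`, and because one
-- relation, flipped, then serves both inequalities.
module _ {P : Pred (Permutation′ m) 0ℓ} {Q : Pred (Permutation′ n) 0ℓ}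
         (P? : Decidable P) (Q? : Decidable Q) (Q-resp : Q Respects _≈_)
         (R : Permutation′ m → Permutation′ n → Set)
         (total : ∀ σ → P σ → ∃[ τ ] Q τ × R σ τ)
         (injective : ∀ {σ σ′ τ τ′} → R σ τ → R σ′ τ′ → τ ≈ τ′ → σ ≈ σ′)
  where

  private
    image : ∀ i → ∃[ τ ] Q τ × R (List.lookup (filter P? (permutations m)) i) τ
    image i = total _ (All.lookup (All.all-filter P? (permutations m)) (∈-lookup i))

    image∈ : ∀ i → _
    image∈ i = ∈-filter⁺ (permutationSetoid n) Q? (λ {π} {ρ} → Q-resp {π} {ρ})
      (permutations-complete n (proj₁ (image i))) (proj₁ (proj₂ (image i)))

  count-≤ : count P? ≤ count Q?
  -- An index of the first list goes to the position of an image in the second. Equal positions give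
  -- `_≈_` images, hence `_≈_` sources, and a list without duplicates turns these into equal
  -- indices.
  count-≤ = injective⇒≤ {f = λ i → index (image∈ i)} λ {i} {j} eq →
    lookup-injective (Unique.filter⁺ (permutationSetoid m) P? (permutations-unique m)) i j
      (injective (proj₂ (proj₂ (image i))) (proj₂ (proj₂ (image j)))
        (index-injective (permutationSetoid n) {proj₁ (image i)} {proj₁ (image j)} (image∈ i) (image∈ j) eq))

count-≡ : {P : Pred (Permutation′ m) 0ℓ} {Q : Pred (Permutation′ n) 0ℓ}
          (P? : Decidable P) (Q? : Decidable Q) → P Respects _≈_ → Q Respects _≈_ →
          (R : Permutation′ m → Permutation′ n → Set) →
          (∀ σ → P σ → ∃[ τ ] Q τ × R σ τ) →
          (∀ τ → Q τ → ∃[ σ ] P σ × R σ τ) →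
          (∀ {σ σ′ τ τ′} → R σ τ → R σ′ τ′ → σ ≈ σ′ → τ ≈ τ′) →
          (∀ {σ σ′ τ τ′} → R σ τ → R σ′ τ′ → τ ≈ τ′ → σ ≈ σ′) →
          count P? ≡ count Q?
count-≡ P? Q? P-resp Q-resp R totalˡ totalʳ functional injective = ≤-antisym
  (count-≤ P? Q? (λ {π} {ρ} → Q-resp {π} {ρ}) R totalˡ injective)
  (count-≤ Q? P? (λ {π} {ρ} → P-resp {π} {ρ}) (flip R) totalʳ functional)

isDPermutation-resp : IsDPermutation {m} Respects _≈_
isDPermutation-resp p (odd , even) =
  (λ i o → subst (λ j → label i ≤ label j) (p i) (odd i o)) ,
  (λ i e → subst (λ j → label j ≤ label i) (p i) (even i e))

isDumont-resp : IsDumont {m} Respects _≈_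
isDumont-resp p (even , odd) =
  (λ i e → subst (λ j → label j < label i) (p i) (even i e)) ,
  (λ i o → subst (λ j → label i ≤ label j) (p i) (odd i o))

isDumontDerangement-resp : IsDumontDerangement {m} Respects _≈_
isDumontDerangement-resp {x = π} {ρ} p (dumont , deranged) =
  isDumont-resp {x = π} {ρ} p dumont , λ i eq → deranged i (trans (p i) eq)

isFullCycle-resp : IsFullCycle {m} Respects _≈_
isFullCycle-resp {x = π} {ρ} p (a , cover) = a , λ j →
  let k , eq = cover j in k , trans (sym (fold-cong (toℕ k))) eq
  where
  fold-cong : ∀ k → fold a (π ⟨$⟩ʳ_) k ≡ fold a (ρ ⟨$⟩ʳ_) k
  fold-cong zero    = refl
  fold-cong (suc k) = trans (p _) (cong (ρ ⟨$⟩ʳ_) (fold-cong k))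

isDCycle-resp : IsDCycle {m} Respects _≈_
isDCycle-resp {x = π} {ρ} p (d , full) =
  isDPermutation-resp {x = π} {ρ} p d , isFullCycle-resp {x = π} {ρ} p full

-- Parity

2∣n⇒2∤1+n : ∀ {n} → 2 ∣ n → 2 ∤ suc n
2∣n⇒2∤1+n {n} 2∣n 2∣1+n =
  >⇒∤ (s≤s (s≤s z≤n)) (∣m+n∣m⇒∣n (subst (2 ∣_) (+-comm 1 n) 2∣1+n) 2∣n)

2∣n⊎2∣1+n : ∀ n → 2 ∣ n ⊎ 2 ∣ suc n
2∣n⊎2∣1+n zero    = inj₁ (divides 0 refl)
2∣n⊎2∣1+n (suc n) with 2∣n⊎2∣1+n n
... | inj₁ 2∣n   = inj₂ (∣m∣n⇒∣m+n ∣-refl 2∣n)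
... | inj₂ 2∣1+n = inj₁ 2∣1+n

2∤n⇒2∣1+n : ∀ {n} → 2 ∤ n → 2 ∣ suc n
2∤n⇒2∣1+n {n} 2∤n with 2∣n⊎2∣1+n n
... | inj₁ 2∣n   = contradiction 2∣n 2∤n
... | inj₂ 2∣1+n = 2∣1+n

2∤1+n⇒2∣n : ∀ {n} → 2 ∤ suc n → 2 ∣ n
2∤1+n⇒2∣n {n} 2∤1+n with 2∣n⊎2∣1+n n
... | inj₁ 2∣n   = 2∣n
... | inj₂ 2∣1+n = contradiction 2∣1+n 2∤1+n

-- Orbits and full cycles

data Orbit {A : Set} (f : A → A) (a : A) : A → Set where
  here : Orbit f a a
  next : ∀ {b} → Orbit f a b → Orbit f a (f b)

fold∈Orbit : ∀ {A : Set} (f : A → A) a k → Orbit f a (fold a f k)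
fold∈Orbit f a zero    = here
fold∈Orbit f a (suc k) = next (fold∈Orbit f a k)

Orbit⇒fold : ∀ {A : Set} {f : A → A} {a b} → Orbit f a b → ∃[ k ] fold a f k ≡ b
Orbit⇒fold here                = 0 , refl
Orbit⇒fold {f = f} (next a⟶b) = let k , eq = Orbit⇒fold a⟶b in suc k , cong f eq

-- Reachability without the bound on exponents found in `IsFullCycle`, so that splicing can be
-- treated by induction on `Orbit` without counting iterates.
Transitive : Permutation′ m → Set
Transitive {m} π = ∃[ a ] ∀ (j : Fin m) → Orbit (π ⟨$⟩ʳ_) a j

fullCycle⇒transitive : (π : Permutation′ m) → IsFullCycle π → Transitive π
fullCycle⇒transitive π (a , cover) = a , λ j →
  let k , eq = cover j in subst (Orbit _ a) eq (fold∈Orbit _ a (toℕ k))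

fold-cancel : (π : Permutation′ m) → ∀ a i d →
              fold a (π ⟨$⟩ʳ_) i ≡ fold a (π ⟨$⟩ʳ_) (i + d) → a ≡ fold a (π ⟨$⟩ʳ_) d
fold-cancel π a zero    d eq = eq
fold-cancel π a (suc i) d eq = fold-cancel π a i d (⟨$⟩ʳ-injective π eq)

-- The iterates with exponents `0` to `m` cannot all differ in `Fin m`, and injectivity cancels the
-- smaller exponent of a coincidence.
period : (π : Permutation′ m) → ∀ a → ∃[ d ] suc d ≤ m × fold a (π ⟨$⟩ʳ_) (suc d) ≡ a
period {m} π a
  with i , j , i<j , eq ← pigeonhole (ℕ.n<1+n m) (λ i → fold a (π ⟨$⟩ʳ_) (toℕ i))
  -- The inequality unfolds to `suc (toℕ i) ≤ toℕ j`, so `d` is the gap minus one and the period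
  -- `suc d` is positive.
  with d , i+d≡j ← ℕ.m≤n⇒∃[o]m+o≡n i<j
  = d
  , ℕ.≤-trans (ℕ.m≤n+m (suc d) (toℕ i))
      (subst (ℕ._≤ m) (trans (sym i+d≡j) (sym (ℕ.+-suc (toℕ i) d))) (s≤s⁻¹ (toℕ<n j)))
  , sym (fold-cancel π a (toℕ i) (suc d)
      (trans eq (cong (fold a _) (trans (sym i+d≡j) (sym (ℕ.+-suc (toℕ i) d))))))

fold-periodic : ∀ {A : Set} (f : A → A) {a} d → fold a f d ≡ a → ∀ q → fold a f (q * d) ≡ a
fold-periodic f     d eq zero    = refl
fold-periodic f {a} d eq (suc q) = begin
  fold a f (d + q * d)        ≡⟨ fold-+ a f d ⟩
  fold (fold a f (q * d)) f d ≡⟨ cong (λ b → fold b f d) (fold-periodic f d eq q) ⟩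
  fold a f d                  ≡⟨ eq ⟩
  a                           ∎
  where open ≡-Reasoning

-- An exponent reaching `j` is reduced modulo the period of `a`; as that period is at most `m`, the
-- remainder fits in `Fin m`.
transitive⇒fullCycle : (π : Permutation′ m) → Transitive π → IsFullCycle π
transitive⇒fullCycle π (a , orbit) = a , λ j →
  let d , 1+d≤m , eq = period π a
      k , eq′        = Orbit⇒fold (orbit j)
      k<m            = ℕ.<-≤-trans (m%n<n k (suc d)) 1+d≤m
      open ≡-Reasoning
      f              = π ⟨$⟩ʳ_
  in fromℕ< k<m , (begin
    fold a f (toℕ (fromℕ< k<m))                          ≡⟨ cong (fold a f) (toℕ-fromℕ< k<m) ⟩
    fold a f (k % suc d)                                 ≡⟨ cong (λ b → fold b f (k % suc d)) (fold-periodic f (suc d) eq (k / suc d)) ⟨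
    fold (fold a f (k / suc d * suc d)) f (k % suc d)    ≡⟨ fold-+ a f (k % suc d) ⟨
    fold a f (k % suc d + k / suc d * suc d)             ≡⟨ cong (fold a f) (m≡m%n+[m/n]*n k (suc d)) ⟨
    fold a f k                                           ≡⟨ eq′ ⟩
    j                                                    ∎)

-- A fixed point can be entered only from itself, so it would be the base point and the whole orbit,
-- which is absurd with two elements.
transitive⇒deranged : (π : Permutation′ (suc (suc m))) → Transitive π → ∀ i → π ⟨$⟩ʳ i ≢ i
transitive⇒deranged π (a , orbit) i πi≡i = contradiction (trans (only 0F) (sym (only 1F))) λ ()
  where
  backward : ∀ {j} → Orbit (π ⟨$⟩ʳ_) a j → j ≡ i → a ≡ i
  backward here          eq = eq
  backward (next a⟶j) eq = backward a⟶j (⟨$⟩ʳ-injective π (trans eq (sym πi≡i)))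

  forward : ∀ {j} → Orbit (π ⟨$⟩ʳ_) a j → j ≡ i
  forward here          = backward (orbit i) refl
  forward (next a⟶j) = trans (cong (π ⟨$⟩ʳ_) (forward a⟶j)) πi≡i

  only : ∀ j → j ≡ i
  only j = forward (orbit j)

-- Splicing 0 into the cycles of a permutation

-- `_∘ₚ_` applies its left factor first: `q` goes to `zero`, which inherits the image that `q` had.
-- For `q = zero` the new element is a fixed point.
splice : Fin (suc m) → Permutation′ m → Permutation′ (suc m)
splice q π = transpose zero q ∘ₚ lift₀ π

-- The transposition makes `zero` a fixed point before it is removed; the splice point is
-- recoverable as the preimage of `zero`.
cut : Permutation′ (suc m) → Permutation′ m
cut π = remove zero (transpose (π ⟨$⟩ˡ zero) zero ∘ₚ π)

splice-at : ∀ q (π : Permutation′ m) → splice q π ⟨$⟩ʳ q ≡ zero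
splice-at zero    π = refl
splice-at (suc q) π rewrite dec-true (q ≟ q) refl = refl

splice-away : ∀ q (π : Permutation′ m) {j} → q ≢ suc j → splice q π ⟨$⟩ʳ suc j ≡ suc (π ⟨$⟩ʳ j)
splice-away q π {j} q≢ rewrite dec-false (suc j ≟ q) (q≢ ∘ sym) = refl

transposeʳ : (i j : Fin m) → PC.transpose i j j ≡ i
transposeʳ i j with j ≟ i
... | yes j≡i = j≡i
... | no  _ rewrite dec-true (j ≟ j) refl = refl

splice-cut : (π : Permutation′ (suc m)) → splice (π ⟨$⟩ˡ zero) (cut π) ≈ π
splice-cut π i = trans
  (lift₀-remove (transpose q zero ∘ₚ π) (trans (cong (π ⟨$⟩ʳ_) (transposeʳ q zero)) (inverseʳ π)) _)
  (cong (π ⟨$⟩ʳ_) (PC.transpose-inverse q zero))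
  where q = π ⟨$⟩ˡ zero

splice-congʳ : ∀ q {π ρ : Permutation′ m} → π ≈ ρ → splice q π ≈ splice q ρ
splice-congʳ q {π} {ρ} p i = lift₀-cong π ρ p (PC.transpose zero q i)

splice-injective : ∀ {p q} {π ρ : Permutation′ m} → splice p π ≈ splice q ρ → p ≡ q × π ≈ ρ
splice-injective {p = p} {q} {π} {ρ} eq
  with refl ← ⟨$⟩ʳ-injective (splice q ρ) {p} {q} (trans (sym (eq p)) (trans (splice-at p π) (sym (splice-at q ρ))))
  = refl , λ j → suc-injective (begin
    lift₀ π ⟨$⟩ʳ suc j                              ≡⟨ cong (lift₀ π ⟨$⟩ʳ_) (PC.transpose-inverse zero p) ⟨
    splice p π ⟨$⟩ʳ PC.transpose p zero (suc j)     ≡⟨ eq (PC.transpose p zero (suc j)) ⟩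
    splice p ρ ⟨$⟩ʳ PC.transpose p zero (suc j)     ≡⟨ cong (lift₀ ρ ⟨$⟩ʳ_) (PC.transpose-inverse zero p) ⟩
    lift₀ ρ ⟨$⟩ʳ suc j                              ∎)
  where open ≡-Reasoning

module _ {p} (π : Permutation′ (suc m)) (ρ : Permutation′ m) (π≈ : π ≈ splice (suc p) ρ) where

  private
    f = π ⟨$⟩ʳ_
    g = ρ ⟨$⟩ʳ_

    f-at : f (suc p) ≡ zero
    f-at = trans (π≈ (suc p)) (splice-at (suc p) ρ)

    f-away : ∀ {j} → p ≢ j → f (suc j) ≡ suc (g j)
    f-away p≢j = trans (π≈ _) (splice-away (suc p) ρ (p≢j ∘ suc-injective))

    f-step : ∀ {a} j → Orbit f a (suc j) → Orbit f a (suc (g j))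
    f-step j a⟶j with p ≟ j
    -- The step of `g` from `p` is two steps of `f`, with a detour through `zero`.
    ... | yes refl = subst (Orbit f _) (trans (cong f f-at) (π≈ zero)) (next (next a⟶j))
    ... | no  p≢j  = subst (Orbit f _) (f-away p≢j) (next a⟶j)

    f-orbit : ∀ {a j} → Orbit g a j → Orbit f (suc a) (suc j)
    f-orbit here         = here
    f-orbit (next {b} o) = f-step b (f-orbit o)

    -- The first element other than 0 that is met when following f from j on.
    collapse : Fin (suc m) → Fin m
    collapse zero    = g p
    collapse (suc j) = j

    g-step : ∀ {a} j → Orbit g a (collapse j) → Orbit g a (collapse (f j))
    -- `zero` and its image `suc (g p)` collapse to the same element, so this step of `f` is no step
    -- of `g`.
    g-step zero    o rewrite π≈ zero = o
    g-step (suc j) o with p ≟ j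
    ... | yes refl rewrite f-at = next o
    ... | no  p≢j  rewrite f-away p≢j = next o

    g-orbit : ∀ {a j} → Orbit f a j → Orbit g (collapse a) (collapse j)
    g-orbit here         = here
    g-orbit (next {b} o) = g-step b (g-orbit o)

  splice-transitive⁺ : Transitive ρ → Transitive π
  splice-transitive⁺ (a , orbit) = suc a , λ where
    zero    → subst (Orbit f _) f-at (next (f-orbit (orbit p)))
    (suc j) → f-orbit (orbit j)

  splice-transitive⁻ : Transitive π → Transitive ρ
  splice-transitive⁻ (a , orbit) = collapse a , λ j → g-orbit (orbit (suc j))

-- The recursive Foata correspondence

penultimate last : Fin (suc (suc m))
penultimate = inject₁ (fromℕ _)
last        = fromℕ _

embed : Fin m → Fin (suc (suc m))
embed i = inject₁ (inject₁ i)

toℕ-embed : (i : Fin m) → toℕ (embed i) ≡ toℕ i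
toℕ-embed i = trans (toℕ-inject₁ _) (toℕ-inject₁ i)

even-last : 2 ∣ m → Even (last {m})
even-last {m} 2∣m = subst (λ k → 2 ∣ suc k) (sym (toℕ-fromℕ (suc m))) (∣m∣n⇒∣m+n ∣-refl 2∣m)

odd-penultimate : 2 ∣ m → Odd (penultimate {m})
odd-penultimate {m} 2∣m =
  subst (λ k → 2 ∤ suc k) (sym (trans (toℕ-inject₁ (fromℕ m)) (toℕ-fromℕ m))) (2∣n⇒2∤1+n 2∣m)

-- Lists the places in a cycle on [m + 2] where a new least element may be inserted: after anything
-- but `penultimate`, whose image has to stay `last`. The value at `zero` matches a new fixed point
-- of `σ` with insertion after the maximum.
splicePoint : Fin (suc m) → Fin (suc (suc m))
splicePoint zero    = last
splicePoint (suc p) = embed p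

splicePoint-injective : ∀ (p q : Fin (suc m)) → splicePoint p ≡ splicePoint q → p ≡ q
splicePoint-injective zero    zero    eq = refl
splicePoint-injective zero    (suc q) eq = contradiction eq fromℕ≢inject₁
splicePoint-injective (suc p) zero    eq = contradiction (sym eq) fromℕ≢inject₁
splicePoint-injective (suc p) (suc q) eq = cong suc (inject₁-injective (inject₁-injective eq))

splicePoint≢penultimate : (p : Fin (suc m)) → splicePoint p ≢ penultimate
splicePoint≢penultimate zero    eq = fromℕ≢inject₁ eq
splicePoint≢penultimate (suc p) eq = fromℕ≢inject₁ (sym (inject₁-injective eq))

infix 4 _∼_

-- The graph of the bijection, closed under `_≈_` through its premises. Each `step` uses one `p` on
-- both sides; `base` pairs the empty permutation with the 2-cycle.
data _∼_ : Permutation′ m → Permutation′ (suc (suc m)) → Set where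
  base : {σ : Permutation′ 0} {c : Permutation′ 2} → c ⟨$⟩ʳ 0F ≡ 1F → σ ∼ c
  step : ∀ {σ′ c′} {σ : Permutation′ (suc m)} {c : Permutation′ (suc (suc (suc m)))} p →
         σ′ ∼ c′ → σ ≈ splice p σ′ → c ≈ splice (suc (splicePoint p)) c′ → σ ∼ c

image-of-1F : (c : Permutation′ 2) → c ⟨$⟩ʳ 0F ≡ 1F → c ⟨$⟩ʳ 1F ≡ 0F
image-of-1F c c0≡1 with c ⟨$⟩ʳ 1F in c1
... | 0F = refl
... | 1F = contradiction (⟨$⟩ʳ-injective c (trans c0≡1 (sym c1))) λ ()

∼-functional : {σ σ₁ : Permutation′ m} {c c₁ : Permutation′ (suc (suc m))} →
               σ ∼ c → σ₁ ∼ c₁ → σ ≈ σ₁ → c ≈ c₁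
∼-functional (base c0) (base c₁0) _ 0F = trans c0 (sym c₁0)
∼-functional {c = c} {c₁} (base c0) (base c₁0) _ 1F = trans (image-of-1F c c0) (sym (image-of-1F c₁ c₁0))
∼-functional (step {σ′ = σ′} {c′} p σ′∼c′ σ≈ c≈) (step {σ′ = σ′₁} {c′₁} p₁ σ′₁∼c′₁ σ₁≈ c₁≈) σ≈σ₁ i
  with refl , σ′≈σ′₁ ← splice-injective {p = p} {p₁} {σ′} {σ′₁} (λ i → trans (sym (σ≈ i)) (trans (σ≈σ₁ i) (σ₁≈ i)))
  = trans (c≈ i) (trans (splice-congʳ (suc (splicePoint p)) {c′} {c′₁} (∼-functional σ′∼c′ σ′₁∼c′₁ σ′≈σ′₁) i) (sym (c₁≈ i)))

∼-injective : {σ σ₁ : Permutation′ m} {c c₁ : Permutation′ (suc (suc m))} →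
              σ ∼ c → σ₁ ∼ c₁ → c ≈ c₁ → σ ≈ σ₁
∼-injective (base _) (base _) _ ()
∼-injective (step {σ′ = σ′} {c′} p σ′∼c′ σ≈ c≈) (step {σ′ = σ′₁} {c′₁} p₁ σ′₁∼c′₁ σ₁≈ c₁≈) c≈c₁ i
  with q≡ , c′≈c′₁ ← splice-injective {p = suc (splicePoint p)} {suc (splicePoint p₁)} {c′} {c′₁} (λ i → trans (sym (c≈ i)) (trans (c≈c₁ i) (c₁≈ i)))
  with refl ← splicePoint-injective p p₁ (suc-injective q≡)
  = trans (σ≈ i) (trans (splice-congʳ p {σ′} {σ′₁} (∼-injective σ′∼c′ σ′₁∼c′₁ c′≈c′₁) i) (sym (σ₁≈ i)))

∼-totalˡ : (σ : Permutation′ m) → ∃[ c ] σ ∼ c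
∼-totalˡ {zero}  σ = swap id , base refl
∼-totalˡ {suc m} σ = let c , σ′∼c = ∼-totalˡ (cut σ) in
  splice (suc (splicePoint (σ ⟨$⟩ˡ zero))) c ,
  step (σ ⟨$⟩ˡ zero) σ′∼c (λ i → sym (splice-cut σ i)) (λ _ → refl)

-- The predecessor of `zero` is not `zero`, by transitivity, and does not correspond to
-- `penultimate`, whose image is `last`. It therefore comes from a `splicePoint`, and both
-- hypotheses descend to `cut c`.
∼-totalʳ : (c : Permutation′ (suc (suc m))) → Transitive c → c ⟨$⟩ʳ penultimate ≡ last → ∃[ σ ] σ ∼ c
∼-totalʳ {zero}  c trn top = id , base top
∼-totalʳ {suc m} c trn top with c ⟨$⟩ˡ zero in eq
... | zero  = contradiction (trans (cong (c ⟨$⟩ʳ_) (sym eq)) (inverseʳ c)) (transitive⇒deranged c trn zero)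
... | suc q = let p , q≡ = point in
              let σ , σ∼c′ = ∼-totalʳ (cut c) (splice-transitive⁻ c (cut c) c≈ trn) top′ in
              splice p σ , step p σ∼c′ (λ _ → refl) (subst (λ q → c ≈ splice (suc q) (cut c)) q≡ c≈)
  where
  c≈ : c ≈ splice (suc q) (cut c)
  c≈ i = trans (sym (splice-cut c i)) (cong (λ q → splice q (cut c) ⟨$⟩ʳ i) eq)

  q≢ : q ≢ penultimate
  q≢ refl = contradiction (trans (sym (trans (cong (c ⟨$⟩ʳ_) (sym eq)) (inverseʳ c))) top) λ ()

  top′ : cut c ⟨$⟩ʳ penultimate ≡ last
  top′ = suc-injective (trans (sym (trans (c≈ _) (splice-away (suc q) (cut c) (q≢ ∘ suc-injective)))) top)

  point : ∃[ p ] q ≡ splicePoint p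
  point with view q
  ... | ‵fromℕ             = zero , refl
  ... | ‵inj₁ ‵fromℕ       = contradiction refl q≢
  ... | ‵inj₁ (‵inj₁ {i = p} _) = suc p , refl

∼⇒transitive : {σ : Permutation′ m} {c : Permutation′ (suc (suc m))} → σ ∼ c → Transitive c
∼⇒transitive (base c0) = 0F , λ where
  0F → here
  1F → subst (Orbit _ 0F) c0 (next here)
∼⇒transitive {c = c} (step {c′ = c′} p σ′∼c′ σ≈ c≈) = splice-transitive⁺ c c′ c≈ (∼⇒transitive σ′∼c′)

∼⇒top : {σ : Permutation′ m} {c : Permutation′ (suc (suc m))} → σ ∼ c → c ⟨$⟩ʳ penultimate ≡ last
∼⇒top (base c0) = c0
∼⇒top (step {c′ = c′} p σ′∼c′ σ≈ c≈) = trans (c≈ _)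
  (trans (splice-away (suc (splicePoint p)) c′ (splicePoint≢penultimate p ∘ suc-injective)) (cong suc (∼⇒top σ′∼c′)))

-- The new `zero` is a weak ascent of `σ` and a strict one of `c`, where its image is a successor.
-- An element after which `zero` is spliced drops to `zero` on both sides. Elsewhere the
-- inequalities are those of `σ′` and `c′`, shifted by one.
∼⇒ascents : {σ : Permutation′ m} {c : Permutation′ (suc (suc m))} → σ ∼ c →
            ∀ k → k Fin.≤ (σ ⟨$⟩ʳ k) ⇔ embed k Fin.< (c ⟨$⟩ʳ embed k)
∼⇒ascents (step p σ′∼c′ σ≈ c≈) zero rewrite c≈ zero = mk⇔ (λ _ → s≤s z≤n) (λ _ → z≤n)
∼⇒ascents (step {σ′ = σ′} {c′} p σ′∼c′ σ≈ c≈) (suc j) with p ≟ suc j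
... | yes refl rewrite σ≈ (suc j) | splice-at (suc j) σ′ | c≈ (embed (suc j)) | splice-at (embed (suc j)) c′
    = mk⇔ (λ ()) (λ ())
... | no  p≢ rewrite σ≈ (suc j) | splice-away p σ′ p≢
                   | c≈ (embed (suc j))
                   | splice-away (suc (splicePoint p)) c′ {embed j} (p≢ ∘ splicePoint-injective p (suc j) ∘ suc-injective)
    = let open Equivalence (∼⇒ascents σ′∼c′ j) in
      mk⇔ (s<s ∘ to ∘ s≤s⁻¹) (s≤s ∘ from ∘ s<s⁻¹)

-- Transfer of the Dumont and D-permutation conditions along `_∼_`

module _ {m} (2∣m : 2 ∣ m) {σ : Permutation′ m} {c : Permutation′ (suc (suc m))} (σ∼c : σ ∼ c) where

  private
    f = c ⟨$⟩ʳ_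

  -- The two top labels meet their conditions automatically: `penultimate` goes up to `last`, and
  -- nothing exceeds `last`. `∼⇒ascents` settles the others.
  ∼-dumont⇒dPermutation : IsDumont σ → IsDPermutation c
  ∼-dumont⇒dPermutation (even , odd) = odd′ , even′
    where
    odd′ : ∀ i → Odd i → label i ≤ label (f i)
    odd′ i o with view i
    ... | ‵fromℕ = contradiction (even-last 2∣m) o
    ... | ‵inj₁ ‵fromℕ rewrite ∼⇒top σ∼c = s≤s (≤fromℕ penultimate)
    ... | ‵inj₁ (‵inj₁ {i = k} _) =
      ℕ.<⇒≤ (s<s (Equivalence.to (∼⇒ascents σ∼c k) (s≤s⁻¹ (odd k (subst (λ l → 2 ∤ suc l) (toℕ-embed k) o)))))

    even′ : ∀ i → Even i → label (f i) ≤ label i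
    even′ i e with view i
    ... | ‵fromℕ = s≤s (≤fromℕ _)
    ... | ‵inj₁ ‵fromℕ = contradiction e (odd-penultimate 2∣m)
    ... | ‵inj₁ (‵inj₁ {i = k} _) = s≤s (ℕ.≮⇒≥ λ lt →
      ℕ.<⇒≱ (s<s⁻¹ (even k (subst (λ l → 2 ∣ suc l) (toℕ-embed k) e))) (Equivalence.from (∼⇒ascents σ∼c k) lt))

  -- At odd labels `c` ascends weakly; a cycle has no fixed point, so the ascent is strict, as
  -- `∼⇒ascents` demands.
  ∼-dPermutation⇒dumont : IsDPermutation c → IsDumont σ
  ∼-dPermutation⇒dumont (odd , even) =
    (λ k e → s<s (ℕ.≰⇒> λ le → ℕ.<⇒≱ (Equivalence.to (∼⇒ascents σ∼c k) le)
      (s≤s⁻¹ (even (embed k) (subst (λ l → 2 ∣ suc l) (sym (toℕ-embed k)) e))))) ,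
    (λ k o → s≤s (Equivalence.from (∼⇒ascents σ∼c k) (ℕ.≤∧≢⇒<
      (s≤s⁻¹ (odd (embed k) (subst (λ l → 2 ∤ suc l) (sym (toℕ-embed k)) o)))
      (transitive⇒deranged c (∼⇒transitive σ∼c) (embed k) ∘ sym ∘ toℕ-injective))))

-- `penultimate` has an odd label, so only itself and `last` can be its image, and a cycle fixes
-- nothing.
dPermutation⇒top : 2 ∣ m → (c : Permutation′ (suc (suc m))) → Transitive c → IsDPermutation c →
                   c ⟨$⟩ʳ penultimate ≡ last
dPermutation⇒top {m} 2∣m c trn (odd , _) with c ⟨$⟩ʳ penultimate in eq
... | i with view i
...   | ‵fromℕ = refl
...   | ‵inj₁ {i = j} _ = contradiction
  (trans eq (cong inject₁ (toℕ-injective (ℕ.≤-antisym (≤fromℕ j)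
    (subst₂ _≤_ (toℕ-inject₁ (fromℕ m)) (trans (cong toℕ eq) (toℕ-inject₁ j))
      (s≤s⁻¹ (odd penultimate (odd-penultimate 2∣m))))))))
  (transitive⇒deranged c trn penultimate)

#DCycles≡#Dumont : 2 ∣ m → count (isDCycle? {suc (suc m)}) ≡ count (isDumont? {m})
#DCycles≡#Dumont 2∣m = sym (count-≡ isDumont? isDCycle?
  (λ {π} {ρ} → isDumont-resp {x = π} {ρ}) (λ {π} {ρ} → isDCycle-resp {x = π} {ρ}) _∼_
  (λ σ d → let c , σ∼c = ∼-totalˡ σ in
    c , (∼-dumont⇒dPermutation 2∣m σ∼c d , transitive⇒fullCycle c (∼⇒transitive σ∼c)) , σ∼c)
  (λ c (d , full) →
    let trn = fullCycle⇒transitive c full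
        σ , σ∼c = ∼-totalʳ c trn (dPermutation⇒top 2∣m c trn d)
    in σ , ∼-dPermutation⇒dumont 2∣m σ∼c d , σ∼c)
  ∼-functional ∼-injective)

-- D-permutations and Dumont derangements

middle : Fin m → Fin (suc (suc m))
middle i = suc (inject₁ i)

middle-injective : {i j : Fin m} → middle i ≡ middle j → i ≡ j
middle-injective = inject₁-injective ∘ suc-injective

label-middle : (i : Fin m) → label (middle i) ≡ suc (label i)
label-middle i = cong (2 +_) (toℕ-inject₁ i)

withFixedEnds : Permutation′ m → Permutation′ (suc (suc m))
withFixedEnds {m} σ = lift₀ (insert (fromℕ m) (fromℕ m) σ)

stripEnds : Permutation′ (suc (suc m)) → Permutation′ m
stripEnds {m} ρ = remove (fromℕ m) (remove zero ρ)

punchIn-fromℕ : (i : Fin m) → punchIn (fromℕ m) i ≡ inject₁ i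
punchIn-fromℕ zero    = refl
punchIn-fromℕ (suc i) = cong suc (punchIn-fromℕ i)

insert-at : ∀ i j (π : Permutation′ m) → insert i j π ⟨$⟩ʳ i ≡ j
insert-at i j π with i ≟ i
... | yes _   = refl
... | no  i≢i = contradiction refl i≢i

withFixedEnds-last : (σ : Permutation′ m) → withFixedEnds σ ⟨$⟩ʳ last ≡ last
withFixedEnds-last σ = cong suc (insert-at (fromℕ _) (fromℕ _) σ)

withFixedEnds-middle : (σ : Permutation′ m) → ∀ i → withFixedEnds σ ⟨$⟩ʳ middle i ≡ middle (σ ⟨$⟩ʳ i)
withFixedEnds-middle {m} σ i
  rewrite sym (punchIn-fromℕ i) | insert-punchIn (fromℕ m) (fromℕ m) σ i = cong suc (punchIn-fromℕ (σ ⟨$⟩ʳ i))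

label-withFixedEnds : (σ : Permutation′ m) → ∀ i →
                      label (withFixedEnds σ ⟨$⟩ʳ middle i) ≡ suc (label (σ ⟨$⟩ʳ i))
label-withFixedEnds σ i = trans (cong label (withFixedEnds-middle σ i)) (label-middle (σ ⟨$⟩ʳ i))

withFixedEnds-cong : {σ ρ : Permutation′ m} → σ ≈ ρ → withFixedEnds σ ≈ withFixedEnds ρ
withFixedEnds-cong p zero = refl
withFixedEnds-cong {σ = σ} {ρ} p (suc i) with view i
... | ‵fromℕ = trans (withFixedEnds-last σ) (sym (withFixedEnds-last ρ))
... | ‵inj₁ {i = j} _ =
  trans (withFixedEnds-middle σ j) (trans (cong middle (p j)) (sym (withFixedEnds-middle ρ j)))

withFixedEnds-injective : {σ ρ : Permutation′ m} → withFixedEnds σ ≈ withFixedEnds ρ → σ ≈ ρ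
withFixedEnds-injective {σ = σ} {ρ} p i = middle-injective
  (trans (sym (withFixedEnds-middle σ i)) (trans (p (middle i)) (withFixedEnds-middle ρ i)))

withFixedEnds-stripEnds : (ρ : Permutation′ (suc (suc m))) → ρ ⟨$⟩ʳ zero ≡ zero → ρ ⟨$⟩ʳ last ≡ last →
                          withFixedEnds (stripEnds ρ) ≈ ρ
withFixedEnds-stripEnds {m} ρ ρ0 ρlast i = trans
  (lift₀-cong (insert (fromℕ m) (fromℕ m) (stripEnds ρ)) π inner i) (lift₀-remove ρ ρ0 i)
  where
  π = remove zero ρ

  inner : insert (fromℕ m) (fromℕ m) (remove (fromℕ m) π) ≈ π
  -- `insert-remove` reinserts with image `π ⟨$⟩ʳ fromℕ m`; the fixed last point identifies this
  -- with `fromℕ m`.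
  inner j = subst (λ k → insert (fromℕ m) k (remove (fromℕ m) π) ⟨$⟩ʳ j ≡ π ⟨$⟩ʳ j)
    (suc-injective (trans (lift₀-remove ρ ρ0 last) ρlast)) (insert-remove (fromℕ m) π j)

-- Shifting the labels by one exchanges the parities.
IsShiftedDPermutation : Pred (Permutation′ m) 0ℓ
IsShiftedDPermutation ρ =
    (∀ i → Odd  i → label (ρ ⟨$⟩ʳ i) ≤ label i)
  × (∀ i → Even i → label i ≤ label (ρ ⟨$⟩ʳ i))

isShiftedDPermutation-resp : IsShiftedDPermutation {m} Respects _≈_
isShiftedDPermutation-resp p (odd , even) =
  (λ i o → subst (λ j → label j ≤ label i) (p i) (odd i o)) ,
  (λ i e → subst (λ j → label i ≤ label j) (p i) (even i e))

withFixedEnds-shifted⁺ : {σ : Permutation′ m} → IsDPermutation σ → IsShiftedDPermutation (withFixedEnds σ)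
withFixedEnds-shifted⁺ {m} {σ} (odd , even) = odd′ , even′
  where
  odd′ : ∀ i → Odd i → label (withFixedEnds σ ⟨$⟩ʳ i) ≤ label i
  odd′ zero    o = ℕ.≤-refl
  odd′ (suc i) o with view i
  ... | ‵fromℕ = ℕ.≤-reflexive (cong label (withFixedEnds-last σ))
  ... | ‵inj₁ {i = j} _ = subst₂ _≤_ (sym (label-withFixedEnds σ j)) (sym (label-middle j))
    (s≤s (even j (2∤1+n⇒2∣n (subst (2 ∤_) (label-middle j) o))))

  even′ : ∀ i → Even i → label i ≤ label (withFixedEnds σ ⟨$⟩ʳ i)
  even′ zero    e = ℕ.≤-refl
  even′ (suc i) e with view i
  ... | ‵fromℕ = ℕ.≤-reflexive (cong label (sym (withFixedEnds-last σ)))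
  ... | ‵inj₁ {i = j} _ = subst₂ _≤_ (sym (label-middle j)) (sym (label-withFixedEnds σ j))
    (s≤s (odd j λ 2∣ → 2∣n⇒2∤1+n 2∣ (subst (2 ∣_) (label-middle j) e)))

withFixedEnds-shifted⁻ : {σ : Permutation′ m} → IsShiftedDPermutation (withFixedEnds σ) → IsDPermutation σ
withFixedEnds-shifted⁻ {m} {σ} (odd , even) =
  (λ i o → s≤s⁻¹ (subst₂ _≤_ (label-middle i) (label-withFixedEnds σ i)
    (even (middle i) (subst (2 ∣_) (sym (label-middle i)) (2∤n⇒2∣1+n o))))) ,
  (λ i e → s≤s⁻¹ (subst₂ _≤_ (label-withFixedEnds σ i) (label-middle i)
    (odd (middle i) (subst (2 ∤_) (sym (label-middle i)) (2∣n⇒2∤1+n e)))))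

-- The least label is odd, so its image cannot lie above it; dually, in `shifted-last` the greatest
-- label is even and its image cannot lie below it.
shifted-zero : (ρ : Permutation′ (suc (suc m))) → IsShiftedDPermutation ρ → ρ ⟨$⟩ʳ zero ≡ zero
shifted-zero ρ (odd , _) = toℕ-injective (ℕ.n≤0⇒n≡0 (s≤s⁻¹ (odd zero (>⇒∤ (s≤s (s≤s z≤n))))))

shifted-last : 2 ∣ m → (ρ : Permutation′ (suc (suc m))) → IsShiftedDPermutation ρ → ρ ⟨$⟩ʳ last ≡ last
shifted-last {m} 2∣m ρ (_ , even) = toℕ-injective (ℕ.≤-antisym (≤fromℕ (ρ ⟨$⟩ʳ last))
  (s≤s⁻¹ (even last (even-last 2∣m))))

-- The involution 2j - 1 ↔ 2j of [2q].
partner : ∀ q → Permutation′ (q * 2)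
partner zero    = id
partner (suc q) = swap (partner q)

partner-involutive : ∀ q i → partner q ⟨$⟩ʳ (partner q ⟨$⟩ʳ i) ≡ i
partner-involutive (suc q) 0F            = refl
partner-involutive (suc q) 1F            = refl
partner-involutive (suc q) (suc (suc i)) = cong (λ j → suc (suc j)) (partner-involutive q i)

label-partner-odd : ∀ q i → Odd i → label (partner q ⟨$⟩ʳ i) ≡ suc (label i)
label-partner-odd (suc q) 0F            o = refl
label-partner-odd (suc q) 1F            o = contradiction ∣-refl o
label-partner-odd (suc q) (suc (suc i)) o =
  cong (2 +_) (label-partner-odd q i (o ∘ ∣m∣n⇒∣m+n ∣-refl))

label-partner-even : ∀ q i → Even i → label i ≡ suc (label (partner q ⟨$⟩ʳ i))
label-partner-even (suc q) 0F            e = contradiction e (>⇒∤ (s≤s (s≤s z≤n)))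
label-partner-even (suc q) 1F            e = refl
label-partner-even (suc q) (suc (suc i)) e =
  cong (2 +_) (label-partner-even q i (∣m+n∣m⇒∣n e ∣-refl))

partner-odd : ∀ q i → Odd i → Even (partner q ⟨$⟩ʳ i)
partner-odd q i o = subst (2 ∣_) (sym (label-partner-odd q i o)) (2∤n⇒2∣1+n o)

partner-even : ∀ q i → Even i → Odd (partner q ⟨$⟩ʳ i)
partner-even q i e 2∣ = 2∣n⇒2∤1+n 2∣ (subst (2 ∣_) (label-partner-even q i e) e)

-- Twisting a Dumont derangement by `partner`

module _ q {τ : Permutation′ (q * 2)} where

  private
    p = partner q ⟨$⟩ʳ_

  -- An odd label `i` is sent where `τ` sends `i + 1`, and a strict descent there means at most `i`.
  -- An even `i` is sent where `τ` sends `i - 1`, and a weak ascent without fixed point there means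
  -- at least `i`.
  derangement⇒shifted : IsDumontDerangement τ → IsShiftedDPermutation (partner q ∘ₚ τ)
  derangement⇒shifted ((even , odd) , deranged) =
    (λ i o → s≤s⁻¹ (subst (label (τ ⟨$⟩ʳ p i) <_) (label-partner-odd q i o)
      (even (p i) (partner-odd q i o)))) ,
    (λ i e → subst (_≤ label (τ ⟨$⟩ʳ p i)) (sym (label-partner-even q i e))
      (ℕ.≤∧≢⇒< (odd (p i) (partner-even q i e))
        (deranged (p i) ∘ sym ∘ toℕ-injective ∘ ℕ.suc-injective)))

  -- Every `i` is `p (p i)`, so the same shift by one makes the weak bounds strict, and strict
  -- bounds exclude fixed points.
  shifted⇒derangement : IsShiftedDPermutation (partner q ∘ₚ τ) → IsDumontDerangement τ
  shifted⇒derangement (odd , even) = (below , λ i o → ℕ.<⇒≤ (above i o)) , deranged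
    where
    below : ∀ i → Even i → label (τ ⟨$⟩ʳ i) < label i
    below i e = subst₂ _≤_ (cong (λ j → suc (label (τ ⟨$⟩ʳ j))) (partner-involutive q i))
      (sym (label-partner-even q i e)) (s≤s (odd (p i) (partner-even q i e)))

    above : ∀ i → Odd i → label i < label (τ ⟨$⟩ʳ i)
    above i o = subst₂ _≤_ (label-partner-odd q i o)
      (cong (λ j → label (τ ⟨$⟩ʳ j)) (partner-involutive q i)) (even (p i) (partner-odd q i o))

    deranged : ∀ i → τ ⟨$⟩ʳ i ≢ i
    deranged i eq with even? i
    ... | yes e = ℕ.<-irrefl (cong label eq) (below i e)
    ... | no  o = ℕ.<-irrefl (cong label (sym eq)) (above i o)

-- With `2` on the right, `suc q * 2` unfolds to `suc (suc (q * 2))`, the size of `withFixedEnds σ`.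
-- The twisted derangement is forced to fix both ends, so stripping them loses nothing.
#D≡#DumontDerangements : ∀ q → count (isDPermutation? {q * 2}) ≡ count (isDumontDerangement? {suc q * 2})
#D≡#DumontDerangements q = count-≡ isDPermutation? isDumontDerangement?
  (λ {π} {ρ} → isDPermutation-resp {x = π} {ρ}) (λ {π} {ρ} → isDumontDerangement-resp {x = π} {ρ})
  _~_ totalˡ totalʳ
  (λ {σ} {σ′} {τ} {τ′} → functional {σ} {σ′} {τ} {τ′})
  (λ {σ} {σ′} {τ} {τ′} → injective {σ} {σ′} {τ} {τ′})
  where
  p = partner (suc q)

  _~_ : Permutation′ (q * 2) → Permutation′ (suc q * 2) → Set
  σ ~ τ = p ∘ₚ τ ≈ withFixedEnds σ

  totalˡ : ∀ σ → IsDPermutation σ → ∃[ τ ] IsDumontDerangement τ × σ ~ τ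
  -- As `p` is its own inverse, twisting once more solves `p ∘ₚ τ ≈ withFixedEnds σ` for `τ`.
  totalˡ σ d = p ∘ₚ withFixedEnds σ ,
    shifted⇒derangement (suc q) {p ∘ₚ withFixedEnds σ}
      (isShiftedDPermutation-resp {x = withFixedEnds σ} {p ∘ₚ p ∘ₚ withFixedEnds σ} (sym ∘ σ~τ)
        (withFixedEnds-shifted⁺ {σ = σ} d)) ,
    σ~τ
    where
    σ~τ : p ∘ₚ p ∘ₚ withFixedEnds σ ≈ withFixedEnds σ
    σ~τ i = cong (withFixedEnds σ ⟨$⟩ʳ_) (partner-involutive (suc q) i)

  totalʳ : ∀ τ → IsDumontDerangement τ → ∃[ σ ] IsDPermutation σ × σ ~ τ
  totalʳ τ d = stripEnds ρ ,
    withFixedEnds-shifted⁻ {σ = stripEnds ρ}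
      (isShiftedDPermutation-resp {x = ρ} {withFixedEnds (stripEnds ρ)} σ~τ shifted) ,
    σ~τ
    where
    ρ = p ∘ₚ τ

    shifted : IsShiftedDPermutation ρ
    shifted = derangement⇒shifted (suc q) {τ} d

    σ~τ : ρ ≈ withFixedEnds (stripEnds ρ)
    σ~τ i = sym (withFixedEnds-stripEnds ρ (shifted-zero ρ shifted) (shifted-last (divides-refl q) ρ shifted) i)

  functional : ∀ {σ σ′ τ τ′} → σ ~ τ → σ′ ~ τ′ → σ ≈ σ′ → τ ≈ τ′
  functional {σ} {σ′} {τ} {τ′} r r′ σ≈σ′ i = begin
    τ ⟨$⟩ʳ i                                    ≡⟨ cong (τ ⟨$⟩ʳ_) (partner-involutive (suc q) i) ⟨
    τ ⟨$⟩ʳ (p ⟨$⟩ʳ (p ⟨$⟩ʳ i))                  ≡⟨ r (p ⟨$⟩ʳ i) ⟩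
    withFixedEnds σ ⟨$⟩ʳ (p ⟨$⟩ʳ i)             ≡⟨ withFixedEnds-cong {σ = σ} {σ′} σ≈σ′ (p ⟨$⟩ʳ i) ⟩
    withFixedEnds σ′ ⟨$⟩ʳ (p ⟨$⟩ʳ i)            ≡⟨ r′ (p ⟨$⟩ʳ i) ⟨
    τ′ ⟨$⟩ʳ (p ⟨$⟩ʳ (p ⟨$⟩ʳ i))                 ≡⟨ cong (τ′ ⟨$⟩ʳ_) (partner-involutive (suc q) i) ⟩
    τ′ ⟨$⟩ʳ i                                   ∎
    where open ≡-Reasoning

  injective : ∀ {σ σ′ τ τ′} → σ ~ τ → σ′ ~ τ′ → τ ≈ τ′ → σ ≈ σ′
  injective {σ} {σ′} r r′ τ≈τ′ = withFixedEnds-injective {σ = σ} {σ′}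
    (λ i → trans (sym (r i)) (trans (τ≈τ′ (p ⟨$⟩ʳ i)) (r′ i)))

theorem4p2 : ∀ (n : ℕ) → .{{_ : NonZero n}} → (#DCycles n ≡ genocchi n) × (#DPermutations n ≡ medianGenocchi n)
theorem4p2 n@(suc k) =
  -- For `n = suc k`, `n * 2` unfolds to `suc (suc (k * 2))` and `n * 2 ∸ 2` to `k * 2`, so one
  -- transport along `*-comm` adjusts both sizes.
  subst (λ m → count (isDCycle? {m}) ≡ count (isDumont? {m ∸ 2})) (*-comm n 2)
    (#DCycles≡#Dumont (divides-refl k)) ,
  subst₂ (λ m m′ → count (isDPermutation? {m}) ≡ count (isDumontDerangement? {m′}))
    (*-comm n 2) (trans (cong (2 +_) (*-comm n 2)) (+-comm 2 (2 * n)))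
    (#D≡#DumontDerangements n)
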